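{- For all propositions $A,B,C$, variables $x,y$ and proof-terms $t_1,t_2,t_3$: if $t_1\in[\![A\odot B]\!]$, $(u/x)t_2\in[\![C]\!]$ for all $u\in[\![A]\!]$, and $(v/y)t_3\in[\![C]\!]$ for all $v\in[\![B]\!]$, then $\delta_\odot^\parallel(t_1,[x]t_2,[y]t_3)\in[\![C]\!]$.
   Context: The $\odot$-calculus. Propositions: $A ::= \top \mid \bot \mid A \Rightarrow A \mid A \wedge A \mid A \vee A \mid A \odot A$. Proof-terms: $t ::= x \mid t \parallel u \mid * \mid \delta_\bot(t) \mid \lambda x\, t \mid t\,u \mid \langle t,u\rangle \mid \delta_\wedge(t,[x,y]u) \mid \mathrm{inl}(t) \mid \mathrm{inr}(t) \mid \delta_\vee(t,[x]u,[y]v) \mid t+u \mid \delta_\odot(t,[x]u,[y]v) \mid \delta_\odot^\parallel(t,[x]u,[y]v)$, where $\lambda x$ binds $x$, $[x,y]$ binds $x,y$, and $[x]$, $[y]$ bind $x$, $y$; $(u/x)t$ is capture-avoiding substitution. Ultra-reduction $\longrightarrow$ is the smallest contextual relation (closed under all term constructors) containing $\sigma l\to\sigma r$ for every substitution $\sigma$ and every rule $l\to r$ among: $(\lambda x\,t)\,u\to(u/x)t$; $\delta_\wedge(\langle t,u\rangle,[x,y]v)\to(t/x,u/y)v$; $\delta_\vee(\mathrm{inl}(t),[x]v,[y]w)\to(t/x)v$; $\delta_\vee(\mathrm{inr}(u),[x]v,[y]w)\to(u/y)w$; $\delta_\odot(t+u,[x]v,[y]w)\to(t/x)v$; $\delta_\odot(t+u,[x]v,[y]w)\to(u/y)w$;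 $\delta_\odot^\parallel(t+u,[x]v,[y]w)\to(t/x)v\parallel(u/y)w$; $(\lambda x\,t)\parallel(\lambda x\,u)\to\lambda x\,(t\parallel u)$; $\langle t,u\rangle\parallel\langle v,w\rangle\to\langle t\parallel v,u\parallel w\rangle$; $\delta_\vee(t\parallel u,[x]v,[y]w)\to\delta_\vee(t,[x]v,[y]w)\parallel\delta_\vee(u,[x]v,[y]w)$; $(t+u)\parallel(v+w)\to(t\parallel v)+(u\parallel w)$; $t\parallel t\to t$; $t\parallel u\to t$; $t\parallel u\to u$. $\longrightarrow^*$ is its reflexive-transitive closure; $t$ strongly terminates if there is no infinite ultra-reduction sequence from $t$. Sets $[\![A]\!]$ are defined by induction on $A$: $t\in[\![\top]\!]$ and $t\in[\![\bot]\!]$ iff $t$ strongly terminates; $t\in[\![A\Rightarrow B]\!]$ iff $t$ strongly terminates and whenever $t\longrightarrow^*\lambda x\,u$, then $(v/x)u\in[\![B]\!]$ for every $v\in[\![A]\!]$; $t\in[\![A\wedge B]\!]$ iff $t$ strongly terminates and whenever $t\longrightarrow^*\langle u,v\rangle$, then $u\in[\![A]\!]$ and $v\in[\![B]\!]$; $t\in[\![A\vee B]\!]$ iff $t$ strongly terminates, whenever $t\longrightarrow^*\mathrm{inl}(u)$ then $u\in[\![A]\!]$, and whenever $t\longrightarrow^*\mathrm{inr}(v)$ then $v\in[\![B]\!]$; $t\in[\![A\odot B]\!]$ iff $t$ strongly terminates and whenever $t\longrightarrow^* u+v$, then $u\in[\![A]\!]$ and $v\in[\![B]\!]$. -}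

module Defs where

open import Data.Nat using (ℕ; zero; suc)
open import Data.Product using (_×_)
open import Induction.WellFounded using (Acc)
open import Relation.Binary.Construct.Closure.ReflexiveTransitive using (Star)

data Form : Set where
  ⊤' ⊥' : Form
  _⇒'_ _∧'_ _∨'_ _⊙'_ : Form → Form → Form

-- Proof-terms, de Bruijn indices (untyped, possibly open).
-- Binders: lam binds 1 var; δ∧ binds 2 vars in its body (index 1 = x, index 0 = y);
-- δ∨, δ⊙, δ⊙∥ bind 1 var in each branch.
data Term : Set where
  var   : ℕ → Term
  _∥_   : Term → Term → Term
  star  : Term
  δ⊥    : Term → Term
  lam   : Term → Term
  app   : Term → Term → Term
  pair  : Term → Term → Term
  δ∧    : Term → Term → Term
  inl   : Term → Term
  inr   : Term → Term
  δ∨    : Term → Term → Term → Term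
  _⊕_   : Term → Term → Term
  δ⊙    : Term → Term → Term → Term
  δ⊙∥   : Term → Term → Term → Term

ext : (ℕ → ℕ) → ℕ → ℕ
ext ρ zero    = zero
ext ρ (suc n) = suc (ρ n)

rename : (ℕ → ℕ) → Term → Term
rename ρ (var n)       = var (ρ n)
rename ρ (t ∥ u)       = rename ρ t ∥ rename ρ u
rename ρ star          = star
rename ρ (δ⊥ t)        = δ⊥ (rename ρ t)
rename ρ (lam t)       = lam (rename (ext ρ) t)
rename ρ (app t u)     = app (rename ρ t) (rename ρ u)
rename ρ (pair t u)    = pair (rename ρ t) (rename ρ u)
rename ρ (δ∧ t u)      = δ∧ (rename ρ t) (rename (ext (ext ρ)) u)
rename ρ (inl t)       = inl (rename ρ t)
rename ρ (inr t)       = inr (rename ρ t)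
rename ρ (δ∨ t u v)    = δ∨ (rename ρ t) (rename (ext ρ) u) (rename (ext ρ) v)
rename ρ (t ⊕ u)       = rename ρ t ⊕ rename ρ u
rename ρ (δ⊙ t u v)    = δ⊙ (rename ρ t) (rename (ext ρ) u) (rename (ext ρ) v)
rename ρ (δ⊙∥ t u v)   = δ⊙∥ (rename ρ t) (rename (ext ρ) u) (rename (ext ρ) v)

exts : (ℕ → Term) → ℕ → Term
exts σ zero    = var zero
exts σ (suc n) = rename suc (σ n)

subst : (ℕ → Term) → Term → Term
subst σ (var n)       = σ n
subst σ (t ∥ u)       = subst σ t ∥ subst σ u
subst σ star          = star
subst σ (δ⊥ t)        = δ⊥ (subst σ t)
subst σ (lam t)       = lam (subst (exts σ) t)
subst σ (app t u)     = app (subst σ t) (subst σ u)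
subst σ (pair t u)    = pair (subst σ t) (subst σ u)
subst σ (δ∧ t u)      = δ∧ (subst σ t) (subst (exts (exts σ)) u)
subst σ (inl t)       = inl (subst σ t)
subst σ (inr t)       = inr (subst σ t)
subst σ (δ∨ t u v)    = δ∨ (subst σ t) (subst (exts σ) u) (subst (exts σ) v)
subst σ (t ⊕ u)       = subst σ t ⊕ subst σ u
subst σ (δ⊙ t u v)    = δ⊙ (subst σ t) (subst (exts σ) u) (subst (exts σ) v)
subst σ (δ⊙∥ t u v)   = δ⊙∥ (subst σ t) (subst (exts σ) u) (subst (exts σ) v)

-- single substitution (u/x)t where x is the variable bound at index 0
sub1 : Term → ℕ → Term
sub1 u zero    = u
sub1 u (suc n) = var n

_[_] : Term → Term → Term
t [ u ] = subst (sub1 u) t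

-- double substitution (t/x, u/y)v where x is index 1 and y is index 0
sub2 : Term → Term → ℕ → Term
sub2 t u zero          = u
sub2 t u (suc zero)    = t
sub2 t u (suc (suc n)) = var n

_[_,_] : Term → Term → Term → Term
v [ t , u ] = subst (sub2 t u) v

infix 4 _⟶_
data _⟶_ : Term → Term → Set where
  β⇒     : ∀ {t u} → app (lam t) u ⟶ t [ u ]
  β∧     : ∀ {t u v} → δ∧ (pair t u) v ⟶ v [ t , u ]
  β∨l    : ∀ {t v w} → δ∨ (inl t) v w ⟶ v [ t ]
  β∨r    : ∀ {u v w} → δ∨ (inr u) v w ⟶ w [ u ]
  β⊙l    : ∀ {t u v w} → δ⊙ (t ⊕ u) v w ⟶ v [ t ]
  β⊙r    : ∀ {t u v w} → δ⊙ (t ⊕ u) v w ⟶ w [ u ]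
  β⊙∥    : ∀ {t u v w} → δ⊙∥ (t ⊕ u) v w ⟶ (v [ t ]) ∥ (w [ u ])
  ∥lam   : ∀ {t u} → lam t ∥ lam u ⟶ lam (t ∥ u)
  ∥pair  : ∀ {t u v w} → pair t u ∥ pair v w ⟶ pair (t ∥ v) (u ∥ w)
  ∥δ∨    : ∀ {t u v w} → δ∨ (t ∥ u) v w ⟶ δ∨ t v w ∥ δ∨ u v w
  ∥⊕     : ∀ {t u v w} → (t ⊕ u) ∥ (v ⊕ w) ⟶ (t ∥ v) ⊕ (u ∥ w)
  ∥idem  : ∀ {t} → t ∥ t ⟶ t
  ∥l     : ∀ {t u} → t ∥ u ⟶ t
  ∥r     : ∀ {t u} → t ∥ u ⟶ u
  c∥₁    : ∀ {t t' u} → t ⟶ t' → t ∥ u ⟶ t' ∥ u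
  c∥₂    : ∀ {t u u'} → u ⟶ u' → t ∥ u ⟶ t ∥ u'
  cδ⊥    : ∀ {t t'} → t ⟶ t' → δ⊥ t ⟶ δ⊥ t'
  clam   : ∀ {t t'} → t ⟶ t' → lam t ⟶ lam t'
  capp₁  : ∀ {t t' u} → t ⟶ t' → app t u ⟶ app t' u
  capp₂  : ∀ {t u u'} → u ⟶ u' → app t u ⟶ app t u'
  cpair₁ : ∀ {t t' u} → t ⟶ t' → pair t u ⟶ pair t' u
  cpair₂ : ∀ {t u u'} → u ⟶ u' → pair t u ⟶ pair t u'
  cδ∧₁   : ∀ {t t' u} → t ⟶ t' → δ∧ t u ⟶ δ∧ t' u
  cδ∧₂   : ∀ {t u u'} → u ⟶ u' → δ∧ t u ⟶ δ∧ t u'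
  cinl   : ∀ {t t'} → t ⟶ t' → inl t ⟶ inl t'
  cinr   : ∀ {t t'} → t ⟶ t' → inr t ⟶ inr t'
  cδ∨₁   : ∀ {t t' u v} → t ⟶ t' → δ∨ t u v ⟶ δ∨ t' u v
  cδ∨₂   : ∀ {t u u' v} → u ⟶ u' → δ∨ t u v ⟶ δ∨ t u' v
  cδ∨₃   : ∀ {t u v v'} → v ⟶ v' → δ∨ t u v ⟶ δ∨ t u v'
  c⊕₁    : ∀ {t t' u} → t ⟶ t' → t ⊕ u ⟶ t' ⊕ u
  c⊕₂    : ∀ {t u u'} → u ⟶ u' → t ⊕ u ⟶ t ⊕ u'
  cδ⊙₁   : ∀ {t t' u v} → t ⟶ t' → δ⊙ t u v ⟶ δ⊙ t' u v
  cδ⊙₂   : ∀ {t u u' v} → u ⟶ u' → δ⊙ t u v ⟶ δ⊙ t u' v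
  cδ⊙₃   : ∀ {t u v v'} → v ⟶ v' → δ⊙ t u v ⟶ δ⊙ t u v'
  cδ⊙∥₁  : ∀ {t t' u v} → t ⟶ t' → δ⊙∥ t u v ⟶ δ⊙∥ t' u v
  cδ⊙∥₂  : ∀ {t u u' v} → u ⟶ u' → δ⊙∥ t u v ⟶ δ⊙∥ t u' v
  cδ⊙∥₃  : ∀ {t u v v'} → v ⟶ v' → δ⊙∥ t u v ⟶ δ⊙∥ t u v'

infix 4 _⟶*_
_⟶*_ : Term → Term → Set
_⟶*_ = Star _⟶_

_⟵_ : Term → Term → Set
u ⟵ t = t ⟶ u

SN : Term → Set
SN t = Acc _⟵_ t

⟦_⟧ : Form → Term → Set
⟦ ⊤' ⟧ t = SN t
⟦ ⊥' ⟧ t = SN t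
⟦ A ⇒' B ⟧ t = SN t × (∀ u → t ⟶* lam u → ∀ v → ⟦ A ⟧ v → ⟦ B ⟧ (u [ v ]))
⟦ A ∧' B ⟧ t = SN t × (∀ u v → t ⟶* pair u v → ⟦ A ⟧ u × ⟦ B ⟧ v)
⟦ A ∨' B ⟧ t = SN t × (∀ u → t ⟶* inl u → ⟦ A ⟧ u) × (∀ v → t ⟶* inr v → ⟦ B ⟧ v)
⟦ A ⊙' B ⟧ t = SN t × (∀ u v → t ⟶* (u ⊕ v) → ⟦ A ⟧ u × ⟦ B ⟧ v)

-- Every ⟦ C ⟧ consists of strongly terminating terms, is closed under reduction and
-- under ∥, and contains every neutral term all of whose one-step reducts it contains
-- (so in particular the variables; hence t₂ and t₃ terminate, as t₂ [ x ] and t₃ [ x ]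
-- do). Since δ⊙∥ t₁ t₂ t₃ is neutral, induction on the termination of t₁, t₂, t₃
-- reduces the theorem to its one-step reducts: a step inside some tᵢ preserves the
-- hypotheses because reduction commutes with substitution, and the root step from
-- t₁ = u ⊕ v to t₂ [ u ] ∥ t₃ [ v ] is handled by closure under ∥. That closure is the
-- one non-standard ingredient: as ∥ distributes over λ, pairs and sums, termination of
-- t ∥ u is proved by induction along "one-step reduct or immediate subterm of an
-- introduction", an order that is well-founded on strongly terminating terms.

module Submission where

open import Defs
open import Data.Nat using (zero; suc)
open import Data.Product using (∃; _×_; _,_; proj₁; proj₂)
open import Data.Empty using (⊥-elim)
open import Function using (_∘_)
open import Induction.WellFounded using (Acc; acc)
open import Relation.Nullary using (¬_)
open import Relation.Binary.Construct.Closure.ReflexiveTransitive using (Star; ε; _◅_; _◅◅_; gmap)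
open import Relation.Binary.PropositionalEquality using (_≡_; refl; sym; trans; cong; cong₂; _≗_; module ≡-Reasoning)

variable
  s s′ t t′ t₁ t₂ u u′ u₁ u₂ w w₁ w₂ : Term

cong₃ : ∀ {A B C D : Set} (f : A → B → C → D) {a a′ b b′ c c′} →
        a ≡ a′ → b ≡ b′ → c ≡ c′ → f a b c ≡ f a′ b′ c′
cong₃ f refl refl refl = refl

ext-ext : ∀ {ρ ρ′ θ} → ρ ∘ ρ′ ≗ θ → ext ρ ∘ ext ρ′ ≗ ext θ
ext-ext h zero    = refl
ext-ext h (suc n) = cong suc (h n)

rename-rename : ∀ {ρ ρ′ θ} → ρ ∘ ρ′ ≗ θ → ∀ t → rename ρ (rename ρ′ t) ≡ rename θ t
rename-rename h (var n)     = cong var (h n)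
rename-rename h (a ∥ b)     = cong₂ _∥_ (rename-rename h a) (rename-rename h b)
rename-rename h star        = refl
rename-rename h (δ⊥ a)      = cong δ⊥ (rename-rename h a)
rename-rename h (lam a)     = cong lam (rename-rename (ext-ext h) a)
rename-rename h (app a b)   = cong₂ app (rename-rename h a) (rename-rename h b)
rename-rename h (pair a b)  = cong₂ pair (rename-rename h a) (rename-rename h b)
rename-rename h (δ∧ a b)    = cong₂ δ∧ (rename-rename h a) (rename-rename (ext-ext (ext-ext h)) b)
rename-rename h (inl a)     = cong inl (rename-rename h a)
rename-rename h (inr a)     = cong inr (rename-rename h a)
rename-rename h (δ∨ a b c)  = cong₃ δ∨ (rename-rename h a) (rename-rename (ext-ext h) b) (rename-rename (ext-ext h) c)
rename-rename h (a ⊕ b)     = cong₂ _⊕_ (rename-rename h a) (rename-rename h b)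
rename-rename h (δ⊙ a b c)  = cong₃ δ⊙ (rename-rename h a) (rename-rename (ext-ext h) b) (rename-rename (ext-ext h) c)
rename-rename h (δ⊙∥ a b c) = cong₃ δ⊙∥ (rename-rename h a) (rename-rename (ext-ext h) b) (rename-rename (ext-ext h) c)

exts-ext : ∀ {σ ρ τ} → σ ∘ ρ ≗ τ → exts σ ∘ ext ρ ≗ exts τ
exts-ext h zero    = refl
exts-ext h (suc n) = cong (rename suc) (h n)

subst-rename : ∀ {σ ρ τ} → σ ∘ ρ ≗ τ → ∀ t → subst σ (rename ρ t) ≡ subst τ t
subst-rename h (var n)     = h n
subst-rename h (a ∥ b)     = cong₂ _∥_ (subst-rename h a) (subst-rename h b)
subst-rename h star        = refl
subst-rename h (δ⊥ a)      = cong δ⊥ (subst-rename h a)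
subst-rename h (lam a)     = cong lam (subst-rename (exts-ext h) a)
subst-rename h (app a b)   = cong₂ app (subst-rename h a) (subst-rename h b)
subst-rename h (pair a b)  = cong₂ pair (subst-rename h a) (subst-rename h b)
subst-rename h (δ∧ a b)    = cong₂ δ∧ (subst-rename h a) (subst-rename (exts-ext (exts-ext h)) b)
subst-rename h (inl a)     = cong inl (subst-rename h a)
subst-rename h (inr a)     = cong inr (subst-rename h a)
subst-rename h (δ∨ a b c)  = cong₃ δ∨ (subst-rename h a) (subst-rename (exts-ext h) b) (subst-rename (exts-ext h) c)
subst-rename h (a ⊕ b)     = cong₂ _⊕_ (subst-rename h a) (subst-rename h b)
subst-rename h (δ⊙ a b c)  = cong₃ δ⊙ (subst-rename h a) (subst-rename (exts-ext h) b) (subst-rename (exts-ext h) c)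
subst-rename h (δ⊙∥ a b c) = cong₃ δ⊙∥ (subst-rename h a) (subst-rename (exts-ext h) b) (subst-rename (exts-ext h) c)

ext-exts : ∀ {ρ σ τ} → rename ρ ∘ σ ≗ τ → rename (ext ρ) ∘ exts σ ≗ exts τ
ext-exts h zero = refl
ext-exts {ρ} {σ} {τ} h (suc n) = begin
  rename (ext ρ) (rename suc (σ n)) ≡⟨ rename-rename (λ _ → refl) (σ n) ⟩
  rename (suc ∘ ρ) (σ n)            ≡⟨ rename-rename (λ _ → refl) (σ n) ⟨
  rename suc (rename ρ (σ n))       ≡⟨ cong (rename suc) (h n) ⟩
  rename suc (τ n)                  ∎
  where open ≡-Reasoning

rename-subst : ∀ {ρ σ τ} → rename ρ ∘ σ ≗ τ → ∀ t → rename ρ (subst σ t) ≡ subst τ t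
rename-subst h (var n)     = h n
rename-subst h (a ∥ b)     = cong₂ _∥_ (rename-subst h a) (rename-subst h b)
rename-subst h star        = refl
rename-subst h (δ⊥ a)      = cong δ⊥ (rename-subst h a)
rename-subst h (lam a)     = cong lam (rename-subst (ext-exts h) a)
rename-subst h (app a b)   = cong₂ app (rename-subst h a) (rename-subst h b)
rename-subst h (pair a b)  = cong₂ pair (rename-subst h a) (rename-subst h b)
rename-subst h (δ∧ a b)    = cong₂ δ∧ (rename-subst h a) (rename-subst (ext-exts (ext-exts h)) b)
rename-subst h (inl a)     = cong inl (rename-subst h a)
rename-subst h (inr a)     = cong inr (rename-subst h a)
rename-subst h (δ∨ a b c)  = cong₃ δ∨ (rename-subst h a) (rename-subst (ext-exts h) b) (rename-subst (ext-exts h) c)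
rename-subst h (a ⊕ b)     = cong₂ _⊕_ (rename-subst h a) (rename-subst h b)
rename-subst h (δ⊙ a b c)  = cong₃ δ⊙ (rename-subst h a) (rename-subst (ext-exts h) b) (rename-subst (ext-exts h) c)
rename-subst h (δ⊙∥ a b c) = cong₃ δ⊙∥ (rename-subst h a) (rename-subst (ext-exts h) b) (rename-subst (ext-exts h) c)

exts-exts : ∀ {σ τ θ} → subst σ ∘ τ ≗ θ → subst (exts σ) ∘ exts τ ≗ exts θ
exts-exts h zero = refl
exts-exts {σ} {τ} {θ} h (suc n) = begin
  subst (exts σ) (rename suc (τ n)) ≡⟨ subst-rename (λ _ → refl) (τ n) ⟩
  subst (rename suc ∘ σ) (τ n)      ≡⟨ rename-subst (λ _ → refl) (τ n) ⟨
  rename suc (subst σ (τ n))        ≡⟨ cong (rename suc) (h n) ⟩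
  rename suc (θ n)                  ∎
  where open ≡-Reasoning

subst-subst : ∀ {σ τ θ} → subst σ ∘ τ ≗ θ → ∀ t → subst σ (subst τ t) ≡ subst θ t
subst-subst h (var n)     = h n
subst-subst h (a ∥ b)     = cong₂ _∥_ (subst-subst h a) (subst-subst h b)
subst-subst h star        = refl
subst-subst h (δ⊥ a)      = cong δ⊥ (subst-subst h a)
subst-subst h (lam a)     = cong lam (subst-subst (exts-exts h) a)
subst-subst h (app a b)   = cong₂ app (subst-subst h a) (subst-subst h b)
subst-subst h (pair a b)  = cong₂ pair (subst-subst h a) (subst-subst h b)
subst-subst h (δ∧ a b)    = cong₂ δ∧ (subst-subst h a) (subst-subst (exts-exts (exts-exts h)) b)
subst-subst h (inl a)     = cong inl (subst-subst h a)
subst-subst h (inr a)     = cong inr (subst-subst h a)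
subst-subst h (δ∨ a b c)  = cong₃ δ∨ (subst-subst h a) (subst-subst (exts-exts h) b) (subst-subst (exts-exts h) c)
subst-subst h (a ⊕ b)     = cong₂ _⊕_ (subst-subst h a) (subst-subst h b)
subst-subst h (δ⊙ a b c)  = cong₃ δ⊙ (subst-subst h a) (subst-subst (exts-exts h) b) (subst-subst (exts-exts h) c)
subst-subst h (δ⊙∥ a b c) = cong₃ δ⊙∥ (subst-subst h a) (subst-subst (exts-exts h) b) (subst-subst (exts-exts h) c)

exts-id : ∀ {σ} → σ ≗ var → exts σ ≗ var
exts-id h zero    = refl
exts-id h (suc n) = cong (rename suc) (h n)

subst-id : ∀ {σ} → σ ≗ var → ∀ t → subst σ t ≡ t
subst-id h (var n)     = h n
subst-id h (a ∥ b)     = cong₂ _∥_ (subst-id h a) (subst-id h b)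
subst-id h star        = refl
subst-id h (δ⊥ a)      = cong δ⊥ (subst-id h a)
subst-id h (lam a)     = cong lam (subst-id (exts-id h) a)
subst-id h (app a b)   = cong₂ app (subst-id h a) (subst-id h b)
subst-id h (pair a b)  = cong₂ pair (subst-id h a) (subst-id h b)
subst-id h (δ∧ a b)    = cong₂ δ∧ (subst-id h a) (subst-id (exts-id (exts-id h)) b)
subst-id h (inl a)     = cong inl (subst-id h a)
subst-id h (inr a)     = cong inr (subst-id h a)
subst-id h (δ∨ a b c)  = cong₃ δ∨ (subst-id h a) (subst-id (exts-id h) b) (subst-id (exts-id h) c)
subst-id h (a ⊕ b)     = cong₂ _⊕_ (subst-id h a) (subst-id h b)
subst-id h (δ⊙ a b c)  = cong₃ δ⊙ (subst-id h a) (subst-id (exts-id h) b) (subst-id (exts-id h) c)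
subst-id h (δ⊙∥ a b c) = cong₃ δ⊙∥ (subst-id h a) (subst-id (exts-id h) b) (subst-id (exts-id h) c)

weaken-[] : ∀ t u → rename suc t [ u ] ≡ t
weaken-[] t u = trans (subst-rename (λ _ → refl) t) (subst-id (λ _ → refl) t)

weaken²-[,] : ∀ t u v → subst (sub2 u v) (rename suc (rename suc t)) ≡ t
weaken²-[,] t u v = trans (subst-rename sub2∘suc (rename suc t)) (weaken-[] t u)
  where
  sub2∘suc : sub2 u v ∘ suc ≗ sub1 u
  sub2∘suc zero    = refl
  sub2∘suc (suc n) = refl

subst-[]-comm : ∀ σ t u → subst σ (t [ u ]) ≡ subst (exts σ) t [ subst σ u ]
subst-[]-comm σ t u = trans (subst-subst (λ _ → refl) t) (sym (subst-subst agree t))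
  where
  agree : subst (sub1 (subst σ u)) ∘ exts σ ≗ subst σ ∘ sub1 u
  agree zero    = refl
  agree (suc n) = weaken-[] (σ n) (subst σ u)

subst-[,]-comm : ∀ σ t u v →
  subst σ (subst (sub2 t u) v) ≡ subst (sub2 (subst σ t) (subst σ u)) (subst (exts (exts σ)) v)
subst-[,]-comm σ t u v = trans (subst-subst (λ _ → refl) v) (sym (subst-subst agree v))
  where
  agree : subst (sub2 (subst σ t) (subst σ u)) ∘ exts (exts σ) ≗ subst σ ∘ sub2 t u
  agree zero          = refl
  agree (suc zero)    = refl
  agree (suc (suc n)) = weaken²-[,] (σ n) (subst σ t) (subst σ u)

subst-⟶ : ∀ σ → t ⟶ t′ → subst σ t ⟶ subst σ t′
subst-⟶ σ (β⇒ {t} {u}) rewrite subst-[]-comm σ t u = β⇒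
subst-⟶ σ (β∧ {t} {u} {v}) rewrite subst-[,]-comm σ t u v = β∧
subst-⟶ σ (β∨l {t} {v}) rewrite subst-[]-comm σ v t = β∨l
subst-⟶ σ (β∨r {u} {w = w}) rewrite subst-[]-comm σ w u = β∨r
subst-⟶ σ (β⊙l {t} {v = v}) rewrite subst-[]-comm σ v t = β⊙l
subst-⟶ σ (β⊙r {u = u} {w = w}) rewrite subst-[]-comm σ w u = β⊙r
subst-⟶ σ (β⊙∥ {t} {u} {v} {w}) rewrite subst-[]-comm σ v t | subst-[]-comm σ w u = β⊙∥
subst-⟶ σ ∥lam       = ∥lam
subst-⟶ σ ∥pair      = ∥pair
subst-⟶ σ ∥δ∨        = ∥δ∨
subst-⟶ σ ∥⊕         = ∥⊕
subst-⟶ σ ∥idem      = ∥idem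
subst-⟶ σ ∥l         = ∥l
subst-⟶ σ ∥r         = ∥r
subst-⟶ σ (c∥₁ r)    = c∥₁ (subst-⟶ σ r)
subst-⟶ σ (c∥₂ r)    = c∥₂ (subst-⟶ σ r)
subst-⟶ σ (cδ⊥ r)    = cδ⊥ (subst-⟶ σ r)
subst-⟶ σ (clam r)   = clam (subst-⟶ (exts σ) r)
subst-⟶ σ (capp₁ r)  = capp₁ (subst-⟶ σ r)
subst-⟶ σ (capp₂ r)  = capp₂ (subst-⟶ σ r)
subst-⟶ σ (cpair₁ r) = cpair₁ (subst-⟶ σ r)
subst-⟶ σ (cpair₂ r) = cpair₂ (subst-⟶ σ r)
subst-⟶ σ (cδ∧₁ r)   = cδ∧₁ (subst-⟶ σ r)
subst-⟶ σ (cδ∧₂ r)   = cδ∧₂ (subst-⟶ (exts (exts σ)) r)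
subst-⟶ σ (cinl r)   = cinl (subst-⟶ σ r)
subst-⟶ σ (cinr r)   = cinr (subst-⟶ σ r)
subst-⟶ σ (cδ∨₁ r)   = cδ∨₁ (subst-⟶ σ r)
subst-⟶ σ (cδ∨₂ r)   = cδ∨₂ (subst-⟶ (exts σ) r)
subst-⟶ σ (cδ∨₃ r)   = cδ∨₃ (subst-⟶ (exts σ) r)
subst-⟶ σ (c⊕₁ r)    = c⊕₁ (subst-⟶ σ r)
subst-⟶ σ (c⊕₂ r)    = c⊕₂ (subst-⟶ σ r)
subst-⟶ σ (cδ⊙₁ r)   = cδ⊙₁ (subst-⟶ σ r)
subst-⟶ σ (cδ⊙₂ r)   = cδ⊙₂ (subst-⟶ (exts σ) r)
subst-⟶ σ (cδ⊙₃ r)   = cδ⊙₃ (subst-⟶ (exts σ) r)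
subst-⟶ σ (cδ⊙∥₁ r)  = cδ⊙∥₁ (subst-⟶ σ r)
subst-⟶ σ (cδ⊙∥₂ r)  = cδ⊙∥₂ (subst-⟶ (exts σ) r)
subst-⟶ σ (cδ⊙∥₃ r)  = cδ⊙∥₃ (subst-⟶ (exts σ) r)

subst-⟶* : ∀ σ → t ⟶* t′ → subst σ t ⟶* subst σ t′
subst-⟶* σ = gmap (subst σ) (subst-⟶ σ)

SN-subst⁻ : ∀ σ → SN (subst σ t) → SN t
SN-subst⁻ σ (acc f) = acc λ r → SN-subst⁻ σ (f (subst-⟶ σ r))

SN-⟶* : SN t → t ⟶* t′ → SN t′
SN-⟶* sn       ε        = sn
SN-⟶* (acc f) (r ◅ rs) = SN-⟶* (f r) rs

SN-lam : SN t → SN (lam t)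
SN-lam (acc f) = acc λ { (clam r) → SN-lam (f r) }

SN-pair : SN t → SN u → SN (pair t u)
SN-pair snt@(acc f) snu@(acc g) = acc λ
  { (cpair₁ r) → SN-pair (f r) snu
  ; (cpair₂ r) → SN-pair snt (g r)
  }

SN-⊕ : SN t → SN u → SN (t ⊕ u)
SN-⊕ snt@(acc f) snu@(acc g) = acc λ
  { (c⊕₁ r) → SN-⊕ (f r) snu
  ; (c⊕₂ r) → SN-⊕ snt (g r)
  }

lam-⟶* : lam t ⟶* w → ∃ λ t′ → w ≡ lam t′ × t ⟶* t′
lam-⟶* ε = _ , refl , ε
lam-⟶* (clam r ◅ rs) with lam-⟶* rs
... | t′ , refl , p = t′ , refl , r ◅ p

pair-⟶* : pair t u ⟶* w → ∃ λ t′ → ∃ λ u′ → w ≡ pair t′ u′ × t ⟶* t′ × u ⟶* u′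
pair-⟶* ε = _ , _ , refl , ε , ε
pair-⟶* (cpair₁ r ◅ rs) with pair-⟶* rs
... | t′ , u′ , refl , p , q = t′ , u′ , refl , r ◅ p , q
pair-⟶* (cpair₂ r ◅ rs) with pair-⟶* rs
... | t′ , u′ , refl , p , q = t′ , u′ , refl , p , r ◅ q

⊕-⟶* : (t ⊕ u) ⟶* w → ∃ λ t′ → ∃ λ u′ → w ≡ (t′ ⊕ u′) × t ⟶* t′ × u ⟶* u′
⊕-⟶* ε = _ , _ , refl , ε , ε
⊕-⟶* (c⊕₁ r ◅ rs) with ⊕-⟶* rs
... | t′ , u′ , refl , p , q = t′ , u′ , refl , r ◅ p , q
⊕-⟶* (c⊕₂ r ◅ rs) with ⊕-⟶* rs
... | t′ , u′ , refl , p , q = t′ , u′ , refl , p , r ◅ q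

data ∥-Reduct (t u : Term) : Term → Set where
  both      : t ⟶* t′ → u ⟶* u′ → ∥-Reduct t u (t′ ∥ u′)
  left      : t ⟶* w → ∥-Reduct t u w
  right     : u ⟶* w → ∥-Reduct t u w
  dist-lam  : t ⟶* lam t₁ → u ⟶* lam u₁ → t₁ ∥ u₁ ⟶* w → ∥-Reduct t u (lam w)
  dist-pair : t ⟶* pair t₁ t₂ → u ⟶* pair u₁ u₂ →
              t₁ ∥ u₁ ⟶* w₁ → t₂ ∥ u₂ ⟶* w₂ → ∥-Reduct t u (pair w₁ w₂)
  dist-⊕    : t ⟶* (t₁ ⊕ t₂) → u ⟶* (u₁ ⊕ u₂) →
              t₁ ∥ u₁ ⟶* w₁ → t₂ ∥ u₂ ⟶* w₂ → ∥-Reduct t u (w₁ ⊕ w₂)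

∥-Reduct-◅ˡ : t ⟶ t′ → ∥-Reduct t′ u w → ∥-Reduct t u w
∥-Reduct-◅ˡ r (both p q)            = both (r ◅ p) q
∥-Reduct-◅ˡ r (left p)              = left (r ◅ p)
∥-Reduct-◅ˡ r (right q)             = right q
∥-Reduct-◅ˡ r (dist-lam p q s)      = dist-lam (r ◅ p) q s
∥-Reduct-◅ˡ r (dist-pair p q s₁ s₂) = dist-pair (r ◅ p) q s₁ s₂
∥-Reduct-◅ˡ r (dist-⊕ p q s₁ s₂)    = dist-⊕ (r ◅ p) q s₁ s₂

∥-Reduct-◅ʳ : u ⟶ u′ → ∥-Reduct t u′ w → ∥-Reduct t u w
∥-Reduct-◅ʳ r (both p q)            = both p (r ◅ q)
∥-Reduct-◅ʳ r (left p)              = left p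
∥-Reduct-◅ʳ r (right q)             = right (r ◅ q)
∥-Reduct-◅ʳ r (dist-lam p q s)      = dist-lam p (r ◅ q) s
∥-Reduct-◅ʳ r (dist-pair p q s₁ s₂) = dist-pair p (r ◅ q) s₁ s₂
∥-Reduct-◅ʳ r (dist-⊕ p q s₁ s₂)    = dist-⊕ p (r ◅ q) s₁ s₂

∥-⟶*-inv : t ∥ u ⟶* w → ∥-Reduct t u w
∥-⟶*-inv ε                = both ε ε
∥-⟶*-inv (c∥₁ r ◅ rs)     = ∥-Reduct-◅ˡ r (∥-⟶*-inv rs)
∥-⟶*-inv (c∥₂ r ◅ rs)     = ∥-Reduct-◅ʳ r (∥-⟶*-inv rs)
∥-⟶*-inv (∥lam ◅ rs) with lam-⟶* rs
... | _ , refl , s = dist-lam ε ε s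
∥-⟶*-inv (∥pair ◅ rs) with pair-⟶* rs
... | _ , _ , refl , s₁ , s₂ = dist-pair ε ε s₁ s₂
∥-⟶*-inv (∥⊕ ◅ rs) with ⊕-⟶* rs
... | _ , _ , refl , s₁ , s₂ = dist-⊕ ε ε s₁ s₂
∥-⟶*-inv (∥idem ◅ rs)     = left rs
∥-⟶*-inv (∥l ◅ rs)        = left rs
∥-⟶*-inv (∥r ◅ rs)        = right rs

data _⊏_ : Term → Term → Set where
  lam-body : t ⊏ lam t
  pair-fst : t ⊏ pair t u
  pair-snd : u ⊏ pair t u
  ⊕-left   : t ⊏ (t ⊕ u)
  ⊕-right  : u ⊏ (t ⊕ u)

data _≺_ : Term → Term → Set where
  reduct  : t ⟶ t′ → t′ ≺ t
  subterm : t′ ⊏ t → t′ ≺ t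

⊏-⟶ : s ⊏ t → s ⟶ s′ → ∃ λ t′ → t ⟶ t′ × s′ ⊏ t′
⊏-⟶ lam-body r = _ , clam r , lam-body
⊏-⟶ pair-fst r = _ , cpair₁ r , pair-fst
⊏-⟶ pair-snd r = _ , cpair₂ r , pair-snd
⊏-⟶ ⊕-left   r = _ , c⊕₁ r , ⊕-left
⊏-⟶ ⊕-right  r = _ , c⊕₂ r , ⊕-right

⊏*-⟶ : Star _⊏_ s t → s ⟶ s′ → ∃ λ t′ → t ⟶ t′ × Star _⊏_ s′ t′
⊏*-⟶ ε r = _ , r , ε
⊏*-⟶ (p ◅ ps) r with ⊏-⟶ p r
... | _ , r′ , p′ with ⊏*-⟶ ps r′
...   | t′ , r″ , ps′ = t′ , r″ , p′ ◅ ps′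

-- A step inside an introduction-subterm of t is also a step of t, so SN t bounds the
-- ≺-chains starting anywhere beneath t.
mutual
  SN⇒Acc≺ : SN t → ∀ s → Star _⊏_ s t → Acc _≺_ s
  SN⇒Acc≺ sn s p = acc (≺-accessible sn s p)

  ≺-accessible : SN t → ∀ s → Star _⊏_ s t → s′ ≺ s → Acc _≺_ s′
  ≺-accessible (acc f) s p (reduct r) with ⊏*-⟶ p r
  ... | _ , r′ , p′ = SN⇒Acc≺ (f r′) _ p′
  ≺-accessible sn (lam s)    p (subterm lam-body) = SN⇒Acc≺ sn s (lam-body ◅ p)
  ≺-accessible sn (pair s _) p (subterm pair-fst) = SN⇒Acc≺ sn s (pair-fst ◅ p)
  ≺-accessible sn (pair _ s) p (subterm pair-snd) = SN⇒Acc≺ sn s (pair-snd ◅ p)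
  ≺-accessible sn (s ⊕ _)    p (subterm ⊕-left)   = SN⇒Acc≺ sn s (⊕-left ◅ p)
  ≺-accessible sn (_ ⊕ s)    p (subterm ⊕-right)  = SN⇒Acc≺ sn s (⊕-right ◅ p)

Acc≺⇒SN : Acc _≺_ t → SN t
Acc≺⇒SN (acc f) = acc λ r → Acc≺⇒SN (f (reduct r))

Acc≺-∥ : Acc _≺_ t → Acc _≺_ u → SN (t ∥ u)
Acc≺-∥ at@(acc f) au@(acc g) = acc λ
  { (c∥₁ r) → Acc≺-∥ (f (reduct r)) au
  ; (c∥₂ r) → Acc≺-∥ at (g (reduct r))
  ; ∥lam    → SN-lam (Acc≺-∥ (f (subterm lam-body)) (g (subterm lam-body)))
  ; ∥pair   → SN-pair (Acc≺-∥ (f (subterm pair-fst)) (g (subterm pair-fst)))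
                      (Acc≺-∥ (f (subterm pair-snd)) (g (subterm pair-snd)))
  ; ∥⊕      → SN-⊕ (Acc≺-∥ (f (subterm ⊕-left)) (g (subterm ⊕-left)))
                   (Acc≺-∥ (f (subterm ⊕-right)) (g (subterm ⊕-right)))
  ; ∥idem   → Acc≺⇒SN at
  ; ∥l      → Acc≺⇒SN at
  ; ∥r      → Acc≺⇒SN au
  }

SN-∥ : SN t → SN u → SN (t ∥ u)
SN-∥ snt snu = Acc≺-∥ (SN⇒Acc≺ snt _ ε) (SN⇒Acc≺ snu _ ε)

⟦⟧⇒SN : ∀ C → ⟦ C ⟧ t → SN t
⟦⟧⇒SN ⊤'       h = h
⟦⟧⇒SN ⊥'       h = h
⟦⟧⇒SN (A ⇒' B) h = proj₁ h
⟦⟧⇒SN (A ∧' B) h = proj₁ h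
⟦⟧⇒SN (A ∨' B) h = proj₁ h
⟦⟧⇒SN (A ⊙' B) h = proj₁ h

⟦⟧-⟶* : ∀ C → ⟦ C ⟧ t → t ⟶* t′ → ⟦ C ⟧ t′
⟦⟧-⟶* ⊤'       h            p = SN-⟶* h p
⟦⟧-⟶* ⊥'       h            p = SN-⟶* h p
⟦⟧-⟶* (A ⇒' B) (sn , h)     p = SN-⟶* sn p , λ u q → h u (p ◅◅ q)
⟦⟧-⟶* (A ∧' B) (sn , h)     p = SN-⟶* sn p , λ u v q → h u v (p ◅◅ q)
⟦⟧-⟶* (A ∨' B) (sn , h , k) p = SN-⟶* sn p , (λ u q → h u (p ◅◅ q)) , (λ v q → k v (p ◅◅ q))
⟦⟧-⟶* (A ⊙' B) (sn , h)     p = SN-⟶* sn p , λ u v q → h u v (p ◅◅ q)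

data Neutral : Term → Set where
  var  : ∀ {n} → Neutral (var n)
  δ⊥   : Neutral (δ⊥ t)
  app  : Neutral (app t u)
  δ∧   : Neutral (δ∧ t u)
  δ∨   : Neutral (δ∨ t u w)
  δ⊙   : Neutral (δ⊙ t u w)
  δ⊙∥  : Neutral (δ⊙∥ t u w)

neutral-⟶* : Neutral t → ¬ Neutral w → t ⟶* w → ∃ λ t′ → t ⟶ t′ × t′ ⟶* w
neutral-⟶* n ¬n ε        = ⊥-elim (¬n n)
neutral-⟶* n ¬n (r ◅ rs) = _ , r , rs

⟦⟧-neutral : ∀ C → Neutral t → (∀ {t′} → t ⟶ t′ → ⟦ C ⟧ t′) → ⟦ C ⟧ t
⟦⟧-neutral ⊤' n h = acc h
⟦⟧-neutral ⊥' n h = acc h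
⟦⟧-neutral (A ⇒' B) n h = acc (λ r → ⟦⟧⇒SN (A ⇒' B) (h r)) , λ u p →
  let _ , r , rs = neutral-⟶* n (λ ()) p in proj₂ (h r) u rs
⟦⟧-neutral (A ∧' B) n h = acc (λ r → ⟦⟧⇒SN (A ∧' B) (h r)) , λ u v p →
  let _ , r , rs = neutral-⟶* n (λ ()) p in proj₂ (h r) u v rs
⟦⟧-neutral (A ∨' B) n h = acc (λ r → ⟦⟧⇒SN (A ∨' B) (h r)) ,
  (λ u p → let _ , r , rs = neutral-⟶* n (λ ()) p in proj₁ (proj₂ (h r)) u rs) ,
  (λ v p → let _ , r , rs = neutral-⟶* n (λ ()) p in proj₂ (proj₂ (h r)) v rs)
⟦⟧-neutral (A ⊙' B) n h = acc (λ r → ⟦⟧⇒SN (A ⊙' B) (h r)) , λ u v p →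
  let _ , r , rs = neutral-⟶* n (λ ()) p in proj₂ (h r) u v rs

⟦⟧-var : ∀ C n → ⟦ C ⟧ (var n)
⟦⟧-var C n = ⟦⟧-neutral C var λ ()

⟦⟧-∥ : ∀ C → ⟦ C ⟧ t → ⟦ C ⟧ u → ⟦ C ⟧ (t ∥ u)
⟦⟧-∥ ⊤' snt snu = SN-∥ snt snu
⟦⟧-∥ ⊥' snt snu = SN-∥ snt snu
⟦⟧-∥ {t} {u} (A ⇒' B) (snt , ht) (snu , hu) = SN-∥ snt snu , λ w p → via-lam (∥-⟶*-inv p)
  where
  via-lam : ∥-Reduct t u (lam w) → ∀ v → ⟦ A ⟧ v → ⟦ B ⟧ (w [ v ])
  via-lam (left p)         = ht _ p
  via-lam (right q)        = hu _ q
  via-lam (dist-lam p q s) v hv =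
    ⟦⟧-⟶* B (⟦⟧-∥ B (ht _ p v hv) (hu _ q v hv)) (subst-⟶* (sub1 v) s)
⟦⟧-∥ {t} {u} (A ∧' B) (snt , ht) (snu , hu) = SN-∥ snt snu , λ w₁ w₂ p → via-pair (∥-⟶*-inv p)
  where
  via-pair : ∥-Reduct t u (pair w₁ w₂) → ⟦ A ⟧ w₁ × ⟦ B ⟧ w₂
  via-pair (left p)               = ht _ _ p
  via-pair (right q)              = hu _ _ q
  via-pair (dist-pair p q s₁ s₂) with ht _ _ p | hu _ _ q
  ... | a₁ , b₁ | a₂ , b₂ = ⟦⟧-⟶* A (⟦⟧-∥ A a₁ a₂) s₁ , ⟦⟧-⟶* B (⟦⟧-∥ B b₁ b₂) s₂
⟦⟧-∥ {t} {u} (A ∨' B) (snt , hlt , hrt) (snu , hlu , hru) =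
  SN-∥ snt snu , (λ w p → via-inl (∥-⟶*-inv p)) , (λ w p → via-inr (∥-⟶*-inv p))
  where
  via-inl : ∥-Reduct t u (inl w) → ⟦ A ⟧ w
  via-inl (left p)  = hlt _ p
  via-inl (right q) = hlu _ q
  via-inr : ∥-Reduct t u (inr w) → ⟦ B ⟧ w
  via-inr (left p)  = hrt _ p
  via-inr (right q) = hru _ q
⟦⟧-∥ {t} {u} (A ⊙' B) (snt , ht) (snu , hu) = SN-∥ snt snu , λ w₁ w₂ p → via-⊕ (∥-⟶*-inv p)
  where
  via-⊕ : ∥-Reduct t u (w₁ ⊕ w₂) → ⟦ A ⟧ w₁ × ⟦ B ⟧ w₂
  via-⊕ (left p)            = ht _ _ p
  via-⊕ (right q)           = hu _ _ q
  via-⊕ (dist-⊕ p q s₁ s₂) with ht _ _ p | hu _ _ q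
  ... | a₁ , b₁ | a₂ , b₂ = ⟦⟧-⟶* A (⟦⟧-∥ A a₁ a₂) s₁ , ⟦⟧-⟶* B (⟦⟧-∥ B b₁ b₂) s₂

module _ (A B C : Form) where

  δ⊙∥-reducible : ∀ {t₁ t₂ t₃} → SN t₁ → SN t₂ → SN t₃ → ⟦ A ⊙' B ⟧ t₁ →
    (∀ u → ⟦ A ⟧ u → ⟦ C ⟧ (t₂ [ u ])) →
    (∀ v → ⟦ B ⟧ v → ⟦ C ⟧ (t₃ [ v ])) →
    ⟦ C ⟧ (δ⊙∥ t₁ t₂ t₃)
  δ⊙∥-reducible sn₁@(acc f₁) sn₂@(acc f₂) sn₃@(acc f₃) h₁ h₂ h₃ = ⟦⟧-neutral C δ⊙∥ λ
    { (cδ⊙∥₁ r) → δ⊙∥-reducible (f₁ r) sn₂ sn₃ (⟦⟧-⟶* (A ⊙' B) h₁ (r ◅ ε)) h₂ h₃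
    ; (cδ⊙∥₂ r) → δ⊙∥-reducible sn₁ (f₂ r) sn₃ h₁
                    (λ u hu → ⟦⟧-⟶* C (h₂ u hu) (subst-⟶ (sub1 u) r ◅ ε)) h₃
    ; (cδ⊙∥₃ r) → δ⊙∥-reducible sn₁ sn₂ (f₃ r) h₁ h₂
                    (λ v hv → ⟦⟧-⟶* C (h₃ v hv) (subst-⟶ (sub1 v) r ◅ ε))
    ; β⊙∥       → let hu , hv = proj₂ h₁ _ _ ε in ⟦⟧-∥ C (h₂ _ hu) (h₃ _ hv)
    }

mainTheorem11 : ∀ (A B C : Form) (t₁ t₂ t₃ : Term) →
    ⟦ A ⊙' B ⟧ t₁ →
    (∀ u → ⟦ A ⟧ u → ⟦ C ⟧ (t₂ [ u ])) →
    (∀ v → ⟦ B ⟧ v → ⟦ C ⟧ (t₃ [ v ])) →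
    ⟦ C ⟧ (δ⊙∥ t₁ t₂ t₃)
mainTheorem11 A B C t₁ t₂ t₃ h₁ h₂ h₃ =
  δ⊙∥-reducible A B C (⟦⟧⇒SN (A ⊙' B) h₁) (body-SN A h₂) (body-SN B h₃) h₁ h₂ h₃
  where
  body-SN : ∀ D {t} → (∀ u → ⟦ D ⟧ u → ⟦ C ⟧ (t [ u ])) → SN t
  body-SN D h = SN-subst⁻ (sub1 (var 0)) (⟦⟧⇒SN C (h (var 0) (⟦⟧-var D 0)))
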